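{- Let $\mathcal{P}(\mathbb{N})$ be Scott's graph model and $C(A)=\mathbb{N}-A$ the complement function on it. The only repcon topologies for the pca $\mathcal{P}(\mathbb{N})[C]$ are the trivial ones (the discrete and the indiscrete topology).
   Context: A partial combinatory algebra (pca) is a set $\mathcal{A}$ with a partial binary application $(a,b)\mapsto ab$ (associating to the left) such that there are $\mathsf{k},\mathsf{s}\in\mathcal{A}$ with, for all $a,b,c$: $\mathsf{k}ab=a$; $\mathsf{s}ab$ is defined; and whenever $(ac)(bc)$ is defined, $\mathsf{s}abc$ is defined and equals $(ac)(bc)$. A partial function $f:\mathcal{A}\to\mathcal{A}$ is representable in $\mathcal{A}$ if there is $a_f\in\mathcal{A}$ with $a_fa=f(a)$ for all $a$ in the domain of $f$. A topology on a pca $\mathcal{A}$ is repcon if every partial representable function $\mathcal{A}\to\mathcal{A}$ is continuous on its domain (as subspace of $\mathcal{A}$). Every pca contains booleans $\mathsf{T},\mathsf{F}$ with a definition-by-cases element $D$ ($D\mathsf{T}ab=a$, $D\mathsf{F}ab=b$), and standard codings $[a,b]$ of pairs and $[a_0,\ldots,a_{n-1}]$ of finite sequences whose basic operations (length, projections, appending) are representable; fix such choices. For a pca $\mathcal{A}$ and a partial function $f:\mathcal{A}\to\mathcal{A}$, $\mathcal{A}[f]$ is the pca with underlying set $\mathcal{A}$ and application $\cdot_f$ defined by: $a\cdot_f b=c$ iff there is a finite sequence $e_0,\ldots,e_{n-1}$ in $\mathcal{A}$ (on each of which $f$ is defined) such that $a[b,f(e_0),\ldots,f(e_{i-1})]=[\mathsf{F},e_i]$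 for all $i<n$ and $a[b,f(e_0),\ldots,f(e_{n-1})]=[\mathsf{T},c]$. (It is known that this is a pca, that $f$ is representable in it, and that application of $\mathcal{A}$ is representable in it.) Scott's graph model is the set $\mathcal{P}(\mathbb{N})$ of subsets of $\mathbb{N}$ with application $A\circ B=\{n\mid \exists m\,([m,n]\in A,\ e_m\subseteq B)\}$, where $[\cdot,\cdot]$ is a standard bijective pairing on $\mathbb{N}$ and $e_k$ is the finite set $p$ with $k=\sum_{i\in p}2^i$. -}

module Defs where

open import Level using (Level; 0ℓ; _⊔_) renaming (suc to lsuc)
open import Data.Empty using (⊥-elim)
open import Data.Fin.Base using (Fin; toℕ) renaming (zero to fzero; suc to fsuc)
open import Data.List.Base using (List; []; _∷_; _++_; _∷ʳ_; [_]; map; length; take; lookup; tabulate)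
open import Data.List.Membership.Propositional using () renaming (_∈_ to _∈ₗ_; _∉_ to _∉ₗ_)
open import Data.List.Membership.Propositional.Properties using (∈-map⁻)
open import Data.List.Properties using (++-assoc; ++-identityʳ; length-++)
open import Data.List.Relation.Binary.Pointwise as Pointwise using (Pointwise; []; _∷_)
open import Data.List.Relation.Unary.All as All using (All; []; _∷_)
open import Data.List.Relation.Unary.AllPairs.Core using ([]; _∷_)
open import Data.List.Relation.Unary.Any using (here; there)
open import Data.List.Relation.Unary.Unique.Propositional using (Unique)
import Data.List.Relation.Unary.Unique.Propositional.Properties as Unique
open import Data.Nat.Base hiding (_⊔_)
open import Data.Nat.DivMod using (_/_; _%_; m≡m%n+[m/n]*n; [m+kn]%n≡m%n; m%n<n; m/n<m; +-distrib-/; +-distrib-/-∣ʳ; m*n/n≡m; %-distribˡ-+)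
open import Data.Nat.Divisibility using (n∣m*n)
open import Data.Nat.ListAction using (sum)
open import Data.Nat.Properties
open import Data.Product.Base using (∃-syntax; _×_; _,_; proj₁; proj₂; uncurry)
open import Data.Sum.Base as Sum using (_⊎_; inj₁; inj₂)
open import Data.Unit.Base using (⊤; tt)
open import Function.Base using (_∘_; id)
open import Function.Bundles using (_⇔_; _↔_; mk↔ₛ′)
open import Relation.Binary.Bundles using (Setoid)
open import Relation.Binary.Core using (Rel)
open import Relation.Binary.Definitions using (_Respects_)
open import Relation.Binary.PropositionalEquality
  using (_≡_; _≢_; refl; sym; trans; cong; cong₂; subst)
open import Relation.Nullary using (Dec; yes; no)
import Relation.Nullary.Decidable as Dec
open import Relation.Unary using (Pred; _∈_; _∉_; _⊆_; _≐_; ∅; U; ∁; _∩_; ⋃; Empty; Universal)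
open import Relation.Unary.Properties using (≐-sym; ≐-trans)
open import Relation.Unary.Relation.Binary.Equality using (≐-setoid)

private
  variable
    c ℓ p q o t : Level

-- Partial application is given by its graph: a · b ↦ d means that ab is
-- defined and equal to d.  Carriers are setoids because equality of subsets
-- of ℕ is extensional.
record PartialApplicative c ℓ p : Set (lsuc (c ⊔ ℓ ⊔ p)) where
  infix 4 _·_↦_ _·_·_↦_ _·_·_·_↦_
  field
    setoid : Setoid c ℓ
  open Setoid setoid public
    renaming (refl to ≈-refl; sym to ≈-sym; trans to ≈-trans)
  field
    _·_↦_        : Carrier → Carrier → Carrier → Set p
    ↦-resp       : ∀ {a a′ b b′ d d′} → a ≈ a′ → b ≈ b′ → d ≈ d′ → a · b ↦ d → a′ · b′ ↦ d′
    ↦-functional : ∀ {a b d d′} → a · b ↦ d → a · b ↦ d′ → d ≈ d′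

  _·_·_↦_ : Carrier → Carrier → Carrier → Carrier → Set (c ⊔ p)
  a · b₁ · b₂ ↦ d = ∃[ u ] ((a · b₁ ↦ u) × (u · b₂ ↦ d))

  _·_·_·_↦_ : Carrier → Carrier → Carrier → Carrier → Carrier → Set (c ⊔ p)
  a · b₁ · b₂ · b₃ ↦ d = ∃[ u ] ((a · b₁ · b₂ ↦ u) × (u · b₃ ↦ d))

record PCA c ℓ p : Set (lsuc (c ⊔ ℓ ⊔ p)) where
  field
    partialApplicative : PartialApplicative c ℓ p
  open PartialApplicative partialApplicative public
  field
    k s     : Carrier
    k-law   : ∀ a b → k · a · b ↦ a
    s-defd  : ∀ a b → ∃[ d ] s · a · b ↦ d
    s-law   : ∀ {a b x u v d} → a · x ↦ u → b · x ↦ v → u · v ↦ d → s · a · b · x ↦ d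

record PartialFunction (S : Setoid c ℓ) q : Set (c ⊔ ℓ ⊔ lsuc q) where
  open Setoid S
  field
    Graph      : Rel Carrier q
    resp       : ∀ {x x′ y y′} → x ≈ x′ → y ≈ y′ → Graph x y → Graph x′ y′
    functional : ∀ {x y y′} → Graph x y → Graph x y′ → y ≈ y′

Representable : (𝒜 : PartialApplicative c ℓ p) →
                PartialFunction (PartialApplicative.setoid 𝒜) q → Set (c ⊔ p ⊔ q)
Representable 𝒜 f = ∃[ a ] (∀ {x y} → Graph x y → a · x ↦ y)
  where open PartialApplicative 𝒜; open PartialFunction f

-- Only subsets that respect the equality of the setoid are open.  In ⋃-open
-- the index level is large enough to index any family of open sets by itself.
record Topology (S : Setoid c ℓ) o t : Set (lsuc (lsuc o ⊔ c ⊔ t) ⊔ ℓ) where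
  open Setoid S
  field
    Open      : Pred (Pred Carrier o) t
    Open-resp : ∀ {V} → Open V → V Respects _≈_
    ∅-open    : ∀ {V} → V ≐ ∅ → Open V
    U-open    : ∀ {V} → V ≐ U → Open V
    ∩-open    : ∀ {V W} → Open V → Open W → Open (V ∩ W)
    ⋃-open    : ∀ {I : Set (lsuc o ⊔ c ⊔ t)} (W : I → Pred Carrier o) →
                (∀ i → Open (W i)) → ∀ {V} → V ≐ ⋃ I W → Open V

module _ {S : Setoid c ℓ} (τ : Topology S o t) where
  open Setoid S
  open Topology τ

  Discrete : Set (c ⊔ ℓ ⊔ lsuc o ⊔ t)
  Discrete = ∀ (V : Pred Carrier o) → V Respects _≈_ → Open V

  Indiscrete : Set (c ⊔ lsuc o ⊔ t)
  Indiscrete = ∀ (V : Pred Carrier o) → Open V → Empty V ⊎ Universal V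

  -- The preimage of every open set is the trace on dom f of an open set,
  -- that is, it is open in the subspace dom f.
  ContinuousOnDomain : PartialFunction S q → Set (c ⊔ lsuc o ⊔ t ⊔ q)
  ContinuousOnDomain f = ∀ {W} → Open W → ∃[ V ] (Open V × (∀ {x y} → Graph x y → (x ∈ V ⇔ y ∈ W)))
    where open PartialFunction f

-- The combinators play no role in this notion, only the application does.
Repcon : (𝒜 : PartialApplicative c ℓ p) → Topology (PartialApplicative.setoid 𝒜) o t →
         Set (c ⊔ ℓ ⊔ lsuc p ⊔ lsuc o ⊔ t)
Repcon {p = p} 𝒜 τ = (f : PartialFunction setoid p) → Representable 𝒜 f → ContinuousOnDomain τ f
  where open PartialApplicative 𝒜

-- A choice of the standard codings; the numerals serve as the lengths of
-- sequences and as the indices of the projections.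
record Coding (𝒜 : PCA c ℓ p) : Set (c ⊔ ℓ ⊔ p) where
  open PCA 𝒜
  field
    T F D : Carrier
    D-T   : ∀ a b → D · T · a · b ↦ a
    D-F   : ∀ a b → D · F · a · b ↦ b

    pair         : Carrier → Carrier → Carrier
    pair-cong    : ∀ {a a′ b b′} → a ≈ a′ → b ≈ b′ → pair a b ≈ pair a′ b′
    pairᶜ p₀ p₁  : Carrier
    pairᶜ-law    : ∀ a b → pairᶜ · a · b ↦ pair a b
    p₀-law       : ∀ a b → p₀ · pair a b ↦ a
    p₁-law       : ∀ a b → p₁ · pair a b ↦ b

    numeral            : ℕ → Carrier
    sucᶜ predᶜ zero?ᶜ  : Carrier
    sucᶜ-law           : ∀ n → sucᶜ · numeral n ↦ numeral (suc n)
    predᶜ-law          : ∀ n → predᶜ · numeral (suc n) ↦ numeral n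
    zero?ᶜ-zero        : zero?ᶜ · numeral zero ↦ T
    zero?ᶜ-suc         : ∀ n → zero?ᶜ · numeral (suc n) ↦ F

    seq                         : List Carrier → Carrier
    seq-cong                    : ∀ {as bs} → Pointwise _≈_ as bs → seq as ≈ seq bs
    lengthᶜ projectionᶜ appendᶜ : Carrier
    lengthᶜ-law                 : ∀ as → lengthᶜ · seq as ↦ numeral (length as)
    projectionᶜ-law             : ∀ as i → projectionᶜ · numeral (toℕ i) · seq as ↦ lookup as i
    appendᶜ-law                 : ∀ as a → appendᶜ · seq as · a ↦ seq (as ∷ʳ a)

-- The algebra 𝒜[f] is written 𝒜 [ κ , f ], where κ is the choice of codings.
module _ (𝒜 : PCA c ℓ p) (κ : Coding 𝒜) (f : PartialFunction (PCA.setoid 𝒜) q) where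
  open PCA 𝒜
  open Coding κ
  open PartialFunction f

  -- A computation of a ·f b: for i < n the query e i is answered by
  -- v i = f (e i).
  record Dialogue (a b d : Carrier) : Set (c ⊔ p ⊔ q) where
    field
      n       : ℕ
      e v     : Fin n → Carrier
      answer  : ∀ i → Graph (e i) (v i)
      query   : ∀ i → a · seq (b ∷ take (toℕ i) (tabulate v)) ↦ pair F (e i)
      result  : a · seq (b ∷ tabulate v) ↦ pair T d

  private
    Pointwise-refl : ∀ {as} → Pointwise _≈_ as as
    Pointwise-refl = Pointwise.refl ≈-refl

    data Run (a : Carrier) (h : List Carrier) (d : Carrier) : Set (c ⊔ p ⊔ q) where
      done : a · seq h ↦ pair T d → Run a h d
      ask  : ∀ {e v} → a · seq h ↦ pair F e → Graph e v → Run a (h ∷ʳ v) d → Run a h d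

    toRun : ∀ {a d} h n (e v : Fin n → Carrier) → (∀ i → Graph (e i) (v i)) →
            (∀ i → a · seq (h ++ take (toℕ i) (tabulate v)) ↦ pair F (e i)) →
            a · seq (h ++ tabulate v) ↦ pair T d → Run a h d
    toRun {a} h zero e v ans qu res = done (subst (λ l → a · seq l ↦ _) (++-identityʳ h) res)
    toRun {a} h (suc n) e v ans qu res =
      ask (subst (λ l → a · seq l ↦ _) (++-identityʳ h) (qu fzero)) (ans fzero)
        (toRun (h ∷ʳ v fzero) n (e ∘ fsuc) (v ∘ fsuc) (ans ∘ fsuc)
          (λ i → subst (λ l → a · seq l ↦ _) (sym (++-assoc h [ v fzero ] _)) (qu (fsuc i)))
          (subst (λ l → a · seq l ↦ _) (sym (++-assoc h [ v fzero ] _)) res))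

    fst≈ : ∀ {a a′ b b′} → pair a b ≈ pair a′ b′ → a ≈ a′
    fst≈ eq = ↦-functional (p₀-law _ _)
      (↦-resp ≈-refl (≈-sym eq) ≈-refl (p₀-law _ _))

    snd≈ : ∀ {a a′ b b′} → pair a b ≈ pair a′ b′ → b ≈ b′
    snd≈ eq = ↦-functional (p₁-law _ _)
      (↦-resp ≈-refl (≈-sym eq) ≈-refl (p₁-law _ _))

    T≈F⇒≈ : T ≈ F → ∀ x y → x ≈ y
    T≈F⇒≈ eq x y with D-T x y | D-F x y
    ... | u , (w , DT , wx) , uy | u′ , (w′ , DF , w′x) , u′y = ↦-functional uy (↦-resp u′≈u ≈-refl ≈-refl u′y)
      where
      w′≈w : w′ ≈ w
      w′≈w = ↦-functional DF (↦-resp ≈-refl eq ≈-refl DT)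
      u′≈u : u′ ≈ u
      u′≈u = ↦-functional w′x (↦-resp (≈-sym w′≈w) ≈-refl ≈-refl wx)

    Run-functional : ∀ {a h h′ d d′} → Pointwise _≈_ h h′ → Run a h d → Run a h′ d′ → d ≈ d′
    Run-functional {a} {h} {h′} h≈ = go
      where
      same : ∀ {x y} → a · seq h ↦ x → a · seq h′ ↦ y → x ≈ y
      same x y = ↦-functional x (↦-resp ≈-refl (≈-sym (seq-cong h≈)) ≈-refl y)
      go : ∀ {d d′} → Run a h d → Run a h′ d′ → d ≈ d′
      go (done x)    (done y)      = snd≈ (same x y)
      go (done x)    (ask y _ _)   = T≈F⇒≈ (fst≈ (same x y)) _ _
      go (ask x _ _) (done y)      = T≈F⇒≈ (≈-sym (fst≈ (same x y))) _ _
      go (ask x g r) (ask y g′ r′) =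
        Run-functional (Pointwise.++⁺ h≈ (functional g (resp (≈-sym (snd≈ (same x y))) ≈-refl g′) ∷ [])) r r′

  _[_,_] : PartialApplicative c ℓ (c ⊔ p ⊔ q)
  _[_,_] = record
    { setoid       = setoid
    ; _·_↦_        = Dialogue
    ; ↦-resp       = λ a≈ b≈ d≈ δ → let open Dialogue δ in record
        { n = n ; e = e ; v = v ; answer = answer
        ; query  = λ i → ↦-resp a≈ (seq-cong (b≈ ∷ Pointwise-refl)) ≈-refl (query i)
        ; result = ↦-resp a≈ (seq-cong (b≈ ∷ Pointwise-refl)) (pair-cong ≈-refl d≈) result
        }
    ; ↦-functional = λ δ δ′ → Run-functional Pointwise-refl (run δ) (run δ′)
    }
    where
    run : ∀ {a b d} → Dialogue a b d → Run a (b ∷ []) d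
    run δ = toRun _ n e v answer query result where open Dialogue δ

-- Cantor's pairing along diagonals.
triangle : ℕ → ℕ
triangle zero    = zero
triangle (suc n) = suc n + triangle n

⟨_,_⟩ : ℕ → ℕ → ℕ
⟨ m , n ⟩ = triangle (m + n) + n

next : ℕ × ℕ → ℕ × ℕ
next (zero  , n) = suc n , zero
next (suc m , n) = m , suc n

unpair : ℕ → ℕ × ℕ
unpair zero    = zero , zero
unpair (suc k) = next (unpair k)

pair-next : ∀ x → uncurry ⟨_,_⟩ (next x) ≡ suc (uncurry ⟨_,_⟩ x)
pair-next (zero  , n) rewrite +-identityʳ n | +-identityʳ (n + triangle n) = cong suc (+-comm n (triangle n))
pair-next (suc m , n) rewrite +-suc m n = +-suc _ n

pair-unpair : ∀ k → uncurry ⟨_,_⟩ (unpair k) ≡ k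
pair-unpair zero    = refl
pair-unpair (suc k) = trans (pair-next (unpair k)) (cong suc (pair-unpair k))

unpair-pair : ∀ m n → unpair ⟨ m , n ⟩ ≡ (m , n)
unpair-pair m n = onDiagonal (m + n) m n refl
  where
  onDiagonal : ∀ d m n → m + n ≡ d → unpair (triangle d + n) ≡ (m , n)
  onDiagonal zero zero zero _ = refl
  onDiagonal (suc d) m zero eq with trans (sym (+-identityʳ m)) eq
  ... | refl rewrite +-identityʳ (d + triangle d) | +-comm d (triangle d)
    = cong next (onDiagonal d zero d refl)
  onDiagonal d m (suc n) eq rewrite +-suc (triangle d) n
    = cong next (onDiagonal d (suc m) n (trans (sym (+-suc m n)) eq))

pairing : (ℕ × ℕ) ↔ ℕ
pairing = mk↔ₛ′ (uncurry ⟨_,_⟩) unpair pair-unpair (uncurry unpair-pair)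

-- i ∈ e k says that the binary digit of k of weight 2^i is 1; e-Σ and e-surjective
-- show that e k is the finite set p with k = Σ_{i ∈ p} 2^i.
data e (k : ℕ) : Pred ℕ 0ℓ where
  lowest : k % 2 ≡ 1 → e k zero
  higher : ∀ {i} → i ∈ e (k / 2) → e k (suc i)

Σ2^ : List ℕ → ℕ
Σ2^ p = sum (map (2 ^_) p)

e-cong : ∀ {k l i} → k ≡ l → i ∈ e k → i ∈ e l
e-cong refl i∈ = i∈

e? : ∀ k i → Dec (i ∈ e k)
e? k zero    = Dec.map′ lowest (λ { (lowest d) → d }) (k % 2 ≟ 1)
e? k (suc i) = Dec.map′ higher (λ { (higher d) → d }) (e? (k / 2) i)

even : ∀ k → k % 2 ≢ 1 → k % 2 ≡ 0
even k k≢1 with k % 2 | m%n<n k 2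
... | zero        | _ = refl
... | suc zero    | _ = ⊥-elim (k≢1 refl)
... | suc (suc _) | s≤s (s≤s ())

+1/2 : ∀ k → k % 2 ≢ 1 → (k + 1) / 2 ≡ k / 2
+1/2 k k≢1 = trans (+-distrib-/ k 1 (subst (λ z → z + 1 < 2) (sym (even k k≢1)) ≤-refl)) (+-identityʳ (k / 2))

+1%2 : ∀ k → k % 2 ≢ 1 → (k + 1) % 2 ≡ 1
+1%2 k k≢1 = trans (%-distribˡ-+ k 1 2) (cong (λ z → (z + 1) % 2) (even k k≢1))

+2*/2 : ∀ k n → (k + 2 * n) / 2 ≡ k / 2 + n
+2*/2 k n rewrite *-comm 2 n = trans (+-distrib-/-∣ʳ k (n∣m*n n)) (cong (k / 2 +_) (m*n/n≡m n 2))

+2*%2 : ∀ k n → (k + 2 * n) % 2 ≡ k % 2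
+2*%2 k n rewrite *-comm 2 n = [m+kn]%n≡m%n k n 2

e-add⁻ : ∀ i k → i ∉ e k → ∀ {j} → j ∈ e (k + 2 ^ i) → j ≡ i ⊎ j ∈ e k
e-add⁻ zero    k i∉ (lowest _)  = inj₁ refl
e-add⁻ zero    k i∉ (higher j∈) = inj₂ (higher (e-cong (+1/2 k (i∉ ∘ lowest)) j∈))
e-add⁻ (suc i) k i∉ (lowest d)  = inj₂ (lowest (trans (sym (+2*%2 k (2 ^ i))) d))
e-add⁻ (suc i) k i∉ (higher j∈) =
  Sum.map (cong suc) higher (e-add⁻ i (k / 2) (i∉ ∘ higher) (e-cong (+2*/2 k (2 ^ i)) j∈))

e-add⁺ : ∀ i k → i ∉ e k → ∀ {j} → j ≡ i ⊎ j ∈ e k → j ∈ e (k + 2 ^ i)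
e-add⁺ zero    k i∉ (inj₁ refl)        = lowest (+1%2 k (i∉ ∘ lowest))
e-add⁺ zero    k i∉ (inj₂ (lowest d))  = ⊥-elim (i∉ (lowest d))
e-add⁺ zero    k i∉ (inj₂ (higher j∈)) = higher (e-cong (sym (+1/2 k (i∉ ∘ lowest))) j∈)
e-add⁺ (suc i) k i∉ (inj₂ (lowest d))  = lowest (trans (+2*%2 k (2 ^ i)) d)
e-add⁺ (suc i) k i∉ (inj₁ refl)        =
  higher (e-cong (sym (+2*/2 k (2 ^ i))) (e-add⁺ i (k / 2) (i∉ ∘ higher) (inj₁ refl)))
e-add⁺ (suc i) k i∉ (inj₂ (higher j∈)) =
  higher (e-cong (sym (+2*/2 k (2 ^ i))) (e-add⁺ i (k / 2) (i∉ ∘ higher) (inj₂ j∈)))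

e0-empty : ∀ {i} → i ∉ e 0
e0-empty (higher i∈) = e0-empty i∈

e-Σ : ∀ {p} → Unique p → e (Σ2^ p) ≐ (_∈ₗ p)
e-Σ u = e-Σ⁻ u , e-Σ⁺ u
  where
  e-Σ⁻ : ∀ {p} → Unique p → e (Σ2^ p) ⊆ (_∈ₗ p)
  ∉Σ   : ∀ {i p} → Unique (i ∷ p) → i ∉ e (Σ2^ p)
  e-Σ⁻ {[]}    _              j∈ = ⊥-elim (e0-empty j∈)
  e-Σ⁻ {i ∷ p} u@(_ ∷ u′) j∈
    with e-add⁻ i (Σ2^ p) (∉Σ u) (e-cong (+-comm (2 ^ i) (Σ2^ p)) j∈)
  ... | inj₁ j≡i = here j≡i
  ... | inj₂ j∈′ = there (e-Σ⁻ u′ j∈′)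
  ∉Σ (i≢ ∷ u) i∈ = All.lookup i≢ (e-Σ⁻ u i∈) refl

  e-Σ⁺ : ∀ {p} → Unique p → (_∈ₗ p) ⊆ e (Σ2^ p)
  e-Σ⁺ {i ∷ p} u@(_ ∷ u′) {j} j∈ =
    e-cong (+-comm (Σ2^ p) (2 ^ i)) (e-add⁺ i (Σ2^ p) (∉Σ u) (split j∈))
    where
    split : j ∈ₗ i ∷ p → j ≡ i ⊎ j ∈ e (Σ2^ p)
    split (here j≡i)  = inj₁ j≡i
    split (there j∈p) = inj₂ (e-Σ⁺ u′ j∈p)

e-surjective : ∀ k → ∃[ p ] (Unique p × Σ2^ p ≡ k)
e-surjective k = digits k k ≤-refl
  where
  Σ-shift : ∀ p → Σ2^ (map suc p) ≡ Σ2^ p * 2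
  Σ-shift []      = refl
  Σ-shift (i ∷ p) rewrite Σ-shift p | *-distribʳ-+ 2 (2 ^ i) (Σ2^ p) | *-comm 2 (2 ^ i) = refl

  0∉shift : ∀ p → 0 ∉ₗ map suc p
  0∉shift p 0∈ with ∈-map⁻ suc 0∈
  ... | _ , _ , ()

  digits : ∀ b k → k ≤ b → ∃[ p ] (Unique p × Σ2^ p ≡ k)
  digits b       zero      _   = [] , [] , refl
  digits (suc b) k@(suc _) k≤b with digits b (k / 2) (≤-pred (≤-trans (m/n<m k 2 ≤-refl) k≤b))
  ... | p , u , eq with k % 2 ≟ 1
  ...   | yes odd = 0 ∷ map suc p
                  , All.tabulate (λ x∈ 0≡x → 0∉shift p (subst (_∈ₗ map suc p) (sym 0≡x) x∈))
                    ∷ Unique.map⁺ suc-injective u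
                  , trans (cong₂ _+_ (sym odd) (trans (Σ-shift p) (cong (_* 2) eq))) (sym (m≡m%n+[m/n]*n k 2))
  ...   | no ¬odd = map suc p
                  , Unique.map⁺ suc-injective u
                  , trans (cong₂ _+_ (sym (even k ¬odd)) (trans (Σ-shift p) (cong (_* 2) eq)))
                          (sym (m≡m%n+[m/n]*n k 2))

𝒫 : Set₁
𝒫 = Pred ℕ 0ℓ

infixl 7 _∘ᵍ_
_∘ᵍ_ : 𝒫 → 𝒫 → 𝒫
(A ∘ᵍ B) n = ∃[ m ] (⟨ m , n ⟩ ∈ A × e m ⊆ B)

∘ᵍ-cong : ∀ {A A′ B B′} → A ≐ A′ → B ≐ B′ → A ∘ᵍ B ≐ A′ ∘ᵍ B′
∘ᵍ-cong (A⊆ , A⊇) (B⊆ , B⊇) =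
  (λ (m , m∈ , em) → m , A⊆ m∈ , B⊆ ∘ em) , (λ (m , m∈ , em) → m , A⊇ m∈ , B⊇ ∘ em)

graphModel : PartialApplicative (lsuc 0ℓ) 0ℓ 0ℓ
graphModel = record
  { setoid       = ≐-setoid ℕ 0ℓ
  ; _·_↦_        = λ A B C → A ∘ᵍ B ≐ C
  ; ↦-resp       = λ A≐ B≐ C≐ AB → ≐-trans (∘ᵍ-cong (≐-sym A≐) (≐-sym B≐)) (≐-trans AB C≐)
  ; ↦-functional = λ AB AB′ → ≐-trans (≐-sym AB) AB′
  }

-- Φ X depends, monotonically, on a finite part of X only.
record Finitary (Φ : 𝒫 → Set) : Set₁ where
  constructor _,_
  field
    mono : ∀ {X Y} → X ⊆ Y → Φ X → Φ Y
    part : ∀ {X} → Φ X → ∃[ m ] (e m ⊆ X × Φ (e m))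

Continuous : (𝒫 → 𝒫) → Set₁
Continuous F = ∀ n → Finitary (λ X → n ∈ F X)

insert : ∀ i k → ∃[ m ] (e m ≐ (λ j → j ≡ i ⊎ j ∈ e k))
insert i k with e? k i
... | yes i∈ = k , inj₂ , λ { (inj₁ refl) → i∈ ; (inj₂ j∈) → j∈ }
... | no  i∉ = k + 2 ^ i , e-add⁻ i k i∉ , e-add⁺ i k i∉

collect : ∀ p l → ∃[ m ] (e m ≐ (λ j → j ∈ₗ p ⊎ j ∈ e l))
collect []      l = l , inj₂ , λ { (inj₂ j∈) → j∈ }
collect (i ∷ p) l with collect p l
... | k , ek⊆ , ek⊇ with insert i k
...   | m , em⊆ , em⊇ = m , to ∘ em⊆ , em⊇ ∘ from
  where
  to : ∀ {j} → j ≡ i ⊎ j ∈ e k → j ∈ₗ i ∷ p ⊎ j ∈ e l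
  to (inj₁ j≡i) = inj₁ (here j≡i)
  to (inj₂ j∈)  = Sum.map₁ there (ek⊆ j∈)
  from : ∀ {j} → j ∈ₗ i ∷ p ⊎ j ∈ e l → j ≡ i ⊎ j ∈ e k
  from (inj₁ (here j≡i)) = inj₁ j≡i
  from (inj₁ (there j∈)) = inj₂ (ek⊇ (inj₁ j∈))
  from (inj₂ j∈)         = inj₂ (ek⊇ (inj₂ j∈))

singleton : ∀ i → ∃[ m ] (e m ≐ (_≡ i))
singleton i with insert i 0
... | m , em⊆ , em⊇ = m , (λ j∈ → Sum.[ id , ⊥-elim ∘ e0-empty ]′ (em⊆ j∈)) , em⊇ ∘ inj₁

e-union : ∀ k l → ∃[ m ] (e m ≐ (λ j → j ∈ e k ⊎ j ∈ e l))
e-union k l with e-surjective k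
... | p , u , refl with collect p l
...   | m , em⊆ , em⊇ = m , Sum.map₁ (proj₂ (e-Σ u)) ∘ em⊆ , em⊇ ∘ Sum.map₁ (proj₁ (e-Σ u))

module FinitaryClosure where
  open Finitary

  member : ∀ i → Finitary (λ X → i ∈ X)
  member i .mono X⊆Y = X⊆Y
  member i .part {X} i∈ with singleton i
  ... | m , em⊆ , em⊇ = m , (λ j∈ → subst X (sym (em⊆ j∈)) i∈) , em⊇ refl

  constant : ∀ P → Finitary (λ _ → P)
  constant P .mono _ x = x
  constant P .part x = 0 , (λ j∈ → ⊥-elim (e0-empty j∈)) , x

  some : ∀ {I : Set} {Φ : I → 𝒫 → Set} → (∀ i → Finitary (Φ i)) → Finitary (λ X → ∃[ i ] Φ i X)
  some φ .mono X⊆Y (i , x) = i , mono (φ i) X⊆Y x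
  some φ .part (i , x) with part (φ i) x
  ... | m , em⊆ , x′ = m , em⊆ , i , x′

  or : ∀ {Φ Ψ} → Finitary Φ → Finitary Ψ → Finitary (λ X → Φ X ⊎ Ψ X)
  or φ ψ .mono X⊆Y = Sum.map (mono φ X⊆Y) (mono ψ X⊆Y)
  or φ ψ .part (inj₁ x) with part φ x
  ... | m , em⊆ , x′ = m , em⊆ , inj₁ x′
  or φ ψ .part (inj₂ x) with part ψ x
  ... | m , em⊆ , x′ = m , em⊆ , inj₂ x′

  and : ∀ {Φ Ψ} → Finitary Φ → Finitary Ψ → Finitary (λ X → Φ X × Ψ X)
  and φ ψ .mono X⊆Y (x , y) = mono φ X⊆Y x , mono ψ X⊆Y y
  and φ ψ .part {X} (x , y) with part φ x | part ψ y
  ... | k , ek⊆ , x′ | l , el⊆ , y′ with e-union k l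
  ... | m , em⊆ , em⊇ = m , (λ j∈ → Sum.[ ek⊆ , el⊆ ]′ (em⊆ j∈))
                          , mono φ (em⊇ ∘ inj₁) x′ , mono ψ (em⊇ ∘ inj₂) y′

  resp⇔ : ∀ {Φ Ψ : 𝒫 → Set} → (∀ {X} → Φ X → Ψ X) → (∀ {X} → Ψ X → Φ X) → Finitary Φ → Finitary Ψ
  resp⇔ to from φ .mono X⊆Y y = to (mono φ X⊆Y (from y))
  resp⇔ to from φ .part y with part φ (from y)
  ... | m , em⊆ , x = m , em⊆ , to x

  every : ∀ {Φ : ℕ → 𝒫 → Set} → (∀ i → Finitary (Φ i)) → ∀ p → Finitary (λ X → All (λ i → Φ i X) p)
  every φ []      = resp⇔ (λ _ → []) (λ _ → tt) (constant ⊤)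
  every φ (i ∷ p) = resp⇔ (λ (x , xs) → x ∷ xs) (λ { (x ∷ xs) → x , xs }) (and (φ i) (every φ p))

  ⊆-finitary : ∀ m {F} → Continuous F → Finitary (λ X → e m ⊆ F X)
  ⊆-finitary m {F} cF with e-surjective m
  ... | p , u , refl = resp⇔ (λ xs {j} j∈ → All.lookup xs (proj₁ (e-Σ u) j∈))
                             (λ f → All.tabulate (λ j∈ → f (proj₂ (e-Σ u) j∈)))
                             (every cF p)

  apply : ∀ {F G} → Continuous F → Continuous G → Continuous (λ X → F X ∘ᵍ G X)
  apply cF cG n = some (λ m → and (cF ⟨ m , n ⟩) (⊆-finitary m cG))

  identity : Continuous id
  identity = member

  const-continuous : ∀ A → Continuous (λ _ → A)
  const-continuous A n = constant (n ∈ A)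

open FinitaryClosure

graph : (𝒫 → 𝒫) → 𝒫
graph F k = let (m , n) = unpair k in n ∈ F (e m)

graph-β : ∀ {F} → Continuous F → ∀ X → graph F ∘ᵍ X ≐ F X
graph-β {F} cF X =
    (λ {n} (m , k∈ , em⊆) → Finitary.mono (cF n) em⊆ (subst (λ (m , n) → n ∈ F (e m)) (unpair-pair m n) k∈))
  , (λ {n} x → let (m , em⊆ , x′) = Finitary.part (cF n) x in
               m , subst (λ (m , n) → n ∈ F (e m)) (sym (unpair-pair m n)) x′ , em⊆)

graph-continuous : ∀ {F : 𝒫 → 𝒫 → 𝒫} → (∀ B → Continuous (λ A → F A B)) → Continuous (λ A → graph (F A))
graph-continuous cF k = let (m , n) = unpair k in cF (e m) n

graph₂ : (𝒫 → 𝒫 → 𝒫) → 𝒫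
graph₂ F = graph (λ A → graph (F A))

graph₂-β : ∀ {F} → (∀ B → Continuous (λ A → F A B)) → (∀ A → Continuous (F A)) →
           ∀ A B → PartialApplicative._·_·_↦_ graphModel (graph₂ F) A B (F A B)
graph₂-β {F} c₁ c₂ A B = graph (F A) , graph-β (graph-continuous c₁) A , graph-β (c₂ A) B

graph₃ : (𝒫 → 𝒫 → 𝒫 → 𝒫) → 𝒫
graph₃ F = graph (λ A → graph₂ (F A))

graph₃-β : ∀ {F} → (∀ B C → Continuous (λ A → F A B C)) → (∀ A C → Continuous (λ B → F A B C)) →
           (∀ A B → Continuous (F A B)) →
           ∀ A B C → PartialApplicative._·_·_·_↦_ graphModel (graph₃ F) A B C (F A B C)
graph₃-β {F} c₁ c₂ c₃ A B C =
    graph (F A B)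
  , (graph₂ (F A) , graph-β (graph-continuous (λ B → graph-continuous (λ C → c₁ B C))) A
                  , graph-β (graph-continuous (c₂ A)) B)
  , graph-β (c₃ A B) C

𝒫ℕ : PCA (lsuc 0ℓ) 0ℓ 0ℓ
𝒫ℕ = record
  { partialApplicative = graphModel
  ; k      = graph₂ (λ A _ → A)
  ; s      = graph₃ S
  ; k-law  = graph₂-β (λ _ → identity) const-continuous
  ; s-defd = λ A B → let (u , AB , _) = S-β A B ∅ in u , AB
  ; s-law  = λ {A} {B} {X} AX BX UV →
      let (w , AB , wX) = S-β A B X in w , AB , ≐-trans wX (≐-trans (∘ᵍ-cong AX BX) UV)
  }
  where
  S : 𝒫 → 𝒫 → 𝒫 → 𝒫
  S A B X = (A ∘ᵍ X) ∘ᵍ (B ∘ᵍ X)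
  S-β = graph₃-β {S}
    (λ B X → apply (apply identity (const-continuous X)) (const-continuous (B ∘ᵍ X)))
    (λ A X → apply (const-continuous (A ∘ᵍ X)) (apply identity (const-continuous X)))
    (λ A B → apply (apply (const-continuous A) identity) (apply (const-continuous B) identity))

complement : PartialFunction (≐-setoid ℕ 0ℓ) 0ℓ
complement = record
  { Graph      = λ A B → ∁ A ≐ B
  ; resp       = λ (A⊆ , A⊇) B≐ AB → ≐-trans ((λ ¬a a → ¬a (A⊆ a)) , (λ ¬a a → ¬a (A⊇ a))) (≐-trans AB B≐)
  ; functional = λ AB AB′ → ≐-trans (≐-sym AB) AB′
  }

-- The rest shows that Coding 𝒫ℕ is inhabited (graphCoding).

tagged : (ℕ → 𝒫) → 𝒫
tagged G k = let (i , n) = unpair k in n ∈ G i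

part : ℕ → 𝒫 → 𝒫
part i X n = ⟨ i , n ⟩ ∈ X

part-tagged : ∀ i G → part i (tagged G) ≐ G i
part-tagged i G = (λ {n} → subst (λ (i , n) → n ∈ G i) (unpair-pair i n))
                , (λ {n} → subst (λ (i , n) → n ∈ G i) (sym (unpair-pair i n)))

tagged-cong : ∀ {G H} → (∀ i → G i ≐ H i) → tagged G ≐ tagged H
tagged-cong eq = (λ {k} → proj₁ (eq (proj₁ (unpair k)))) , (λ {k} → proj₂ (eq (proj₁ (unpair k))))

tagged-continuous : ∀ {G : 𝒫 → ℕ → 𝒫} → (∀ i → Continuous (λ X → G X i)) → Continuous (λ X → tagged (G X))
tagged-continuous cG k = let (i , n) = unpair k in cG i n

pairᵍ : 𝒫 → 𝒫 → ℕ → 𝒫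
pairᵍ A B zero    = A
pairᵍ A B (suc _) = B

numᵍ : ℕ → 𝒫
numᵍ n = _≡ n

nth : List 𝒫 → ℕ → 𝒫
nth []       _       = ∅
nth (A ∷ _)  zero    = A
nth (_ ∷ As) (suc i) = nth As i

seqᵍ : List 𝒫 → ℕ → 𝒫
seqᵍ As zero    = numᵍ (length As)
seqᵍ As (suc i) = nth As i

-- Case distinction on whether X contains a positive number or zero.
Dᵍ : 𝒫 → 𝒫 → 𝒫 → 𝒫
Dᵍ X A B n = (∃[ i ] (suc i ∈ X × n ∈ A)) ⊎ (0 ∈ X × n ∈ B)

projᵍ : 𝒫 → 𝒫 → 𝒫
projᵍ N As n = ∃[ i ] (i ∈ N × n ∈ part (suc i) As)

appendᵍ : 𝒫 → 𝒫 → ℕ → 𝒫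
appendᵍ As A zero    n = ∃[ l ] (l ∈ part 0 As × n ≡ suc l)
appendᵍ As A (suc i) n = n ∈ part (suc i) As ⊎ (i ∈ part 0 As × n ∈ A)

seqᵍ-cong : ∀ {As Bs} → Pointwise _≐_ As Bs → ∀ i → seqᵍ As i ≐ seqᵍ Bs i
seqᵍ-cong As≐ zero = (λ { refl → Pointwise.Pointwise-length As≐ }) , (λ { refl → sym (Pointwise.Pointwise-length As≐) })
seqᵍ-cong As≐ (suc i) = nth-cong As≐ i
  where
  nth-cong : ∀ {As Bs} → Pointwise _≐_ As Bs → ∀ i → nth As i ≐ nth Bs i
  nth-cong []          i       = id , id
  nth-cong (A≐ ∷ _)    zero    = A≐
  nth-cong (_ ∷ As≐)   (suc i) = nth-cong As≐ i

nth-lookup : ∀ As (i : Fin (length As)) → nth As (toℕ i) ≡ lookup As i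
nth-lookup (_ ∷ _)  fzero    = refl
nth-lookup (_ ∷ As) (fsuc i) = nth-lookup As i

nth-∷ʳ⁻ : ∀ As A i {n} → n ∈ nth (As ∷ʳ A) i → n ∈ nth As i ⊎ (i ≡ length As × n ∈ A)
nth-∷ʳ⁻ []       A zero    n∈ = inj₂ (refl , n∈)
nth-∷ʳ⁻ (_ ∷ _)  A zero    n∈ = inj₁ n∈
nth-∷ʳ⁻ (_ ∷ As) A (suc i) n∈ = Sum.map₂ (λ (i≡ , x) → cong suc i≡ , x) (nth-∷ʳ⁻ As A i n∈)

nth-∷ʳ⁺ : ∀ As A i {n} → n ∈ nth As i ⊎ (i ≡ length As × n ∈ A) → n ∈ nth (As ∷ʳ A) i
nth-∷ʳ⁺ []       A zero    (inj₂ (_ , n∈))  = n∈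
nth-∷ʳ⁺ (_ ∷ _)  A zero    (inj₁ n∈)        = n∈
nth-∷ʳ⁺ (_ ∷ As) A (suc i) (inj₁ n∈)        = nth-∷ʳ⁺ As A i (inj₁ n∈)
nth-∷ʳ⁺ (_ ∷ As) A (suc i) (inj₂ (i≡ , n∈)) = nth-∷ʳ⁺ As A i (inj₂ (suc-injective i≡ , n∈))

appendᵍ-seqᵍ : ∀ As A i → appendᵍ (tagged (seqᵍ As)) A i ≐ seqᵍ (As ∷ʳ A) i
appendᵍ-seqᵍ As A zero = to , from
  where
  z = part-tagged 0 (seqᵍ As)
  to : appendᵍ (tagged (seqᵍ As)) A zero ⊆ numᵍ (length (As ∷ʳ A))
  to (l , l∈ , refl) = trans (cong suc (proj₁ z l∈)) (sym (trans (length-++ As) (+-comm (length As) 1)))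
  from : numᵍ (length (As ∷ʳ A)) ⊆ appendᵍ (tagged (seqᵍ As)) A zero
  from refl = length As , proj₂ z refl , trans (length-++ As) (+-comm (length As) 1)
appendᵍ-seqᵍ As A (suc i) =
    (λ x → nth-∷ʳ⁺ As A i (Sum.map (proj₁ w) (λ (i∈ , n∈) → proj₁ z i∈ , n∈) x))
  , (λ n∈ → Sum.map (proj₂ w) (λ (i≡ , n∈) → proj₂ z i≡ , n∈) (nth-∷ʳ⁻ As A i n∈))
  where
  z = part-tagged 0 (seqᵍ As)
  w = part-tagged (suc i) (seqᵍ As)

graphCoding : Coding 𝒫ℕ
graphCoding = record
  { T = numᵍ 1 ; F = numᵍ 0 ; D = graph₃ Dᵍ
  ; D-T = λ A B → β₃ (numᵍ 1) A B ((λ { (inj₁ (_ , _ , n∈)) → n∈ }) , λ n∈ → inj₁ (0 , refl , n∈))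
  ; D-F = λ A B → β₃ (numᵍ 0) A B ((λ { (inj₂ (_ , n∈)) → n∈ }) , λ n∈ → inj₂ (refl , n∈))
  ; pair      = λ A B → tagged (pairᵍ A B)
  ; pair-cong = λ A≐ B≐ → tagged-cong {pairᵍ _ _} {pairᵍ _ _} λ { zero → A≐ ; (suc _) → B≐ }
  ; pairᶜ     = graph₂ (λ A B → tagged (pairᵍ A B))
  ; pairᶜ-law = graph₂-β (λ B → tagged-continuous {λ A → pairᵍ A B} λ { zero → identity ; (suc _) → const-continuous B })
                         (λ A → tagged-continuous {pairᵍ A} λ { zero → const-continuous A ; (suc _) → identity })
  ; p₀ = graph (part 0) ; p₁ = graph (part 1)
  ; p₀-law = λ A B → ≐-trans (graph-β (λ n → member ⟨ 0 , n ⟩) _) (part-tagged 0 (pairᵍ A B))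
  ; p₁-law = λ A B → ≐-trans (graph-β (λ n → member ⟨ 1 , n ⟩) _) (part-tagged 1 (pairᵍ A B))
  ; numeral = numᵍ
  ; sucᶜ = graph (λ X n → ∃[ i ] (i ∈ X × n ≡ suc i))
  ; predᶜ = graph (λ X n → suc n ∈ X)
  ; zero?ᶜ = graph (λ X n → (0 ∈ X × n ≡ 1) ⊎ ((∃[ i ] suc i ∈ X) × n ≡ 0))
  ; sucᶜ-law = λ n → ≐-trans (graph-β (λ m → some λ i → and (member i) (constant (m ≡ suc i))) _)
                             ((λ { (_ , refl , eq) → eq }) , λ eq → n , refl , eq)
  ; predᶜ-law = λ n → ≐-trans (graph-β (λ m → member (suc m)) _) (suc-injective , cong suc)
  ; zero?ᶜ-zero = ≐-trans (graph-β z-continuous _) ((λ { (inj₁ (_ , eq)) → eq ; (inj₂ ((_ , ()) , _)) }) , λ eq → inj₁ (refl , eq))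
  ; zero?ᶜ-suc = λ n → ≐-trans (graph-β z-continuous _) ((λ { (inj₂ (_ , eq)) → eq ; (inj₁ (() , _)) }) , λ eq → inj₂ ((n , refl) , eq))
  ; seq = λ As → tagged (seqᵍ As)
  ; seq-cong = λ As≐ → tagged-cong (seqᵍ-cong As≐)
  ; lengthᶜ = graph (part 0)
  ; projectionᶜ = graph₂ projᵍ
  ; appendᶜ = graph₂ (λ As A → tagged (appendᵍ As A))
  ; lengthᶜ-law = λ As → ≐-trans (graph-β (λ n → member ⟨ 0 , n ⟩) _) (part-tagged 0 (seqᵍ As))
  ; projectionᶜ-law = projection-law
  ; appendᶜ-law = λ As A → let (w , x , y) = append-β (tagged (seqᵍ As)) A in
                           w , x , ≐-trans y (tagged-cong (appendᵍ-seqᵍ As A))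
  }
  where
  open PartialApplicative graphModel using (_·_·_↦_; _·_·_·_↦_)

  D-β = graph₃-β {Dᵍ}
    (λ A B n → or (some λ i → and (member (suc i)) (constant _)) (and (member 0) (constant _)))
    (λ X B n → or (some λ i → and (constant _) (member n)) (constant _))
    (λ X A n → or (constant _) (and (constant _) (member n)))

  β₃ : ∀ X A B {E} → Dᵍ X A B ≐ E → graph₃ Dᵍ · X · A · B ↦ E
  β₃ X A B eq = let (w , x , y) = D-β X A B in w , x , ≐-trans y eq

  z-continuous : Continuous (λ X n → (0 ∈ X × n ≡ 1) ⊎ ((∃[ i ] suc i ∈ X) × n ≡ 0))
  z-continuous n = or (and (member 0) (constant _)) (and (some λ i → member (suc i)) (constant _))

  projection-law : ∀ As i → graph₂ projᵍ · numᵍ (toℕ i) · tagged (seqᵍ As) ↦ lookup As i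
  projection-law As i =
    let (w , x , y) = graph₂-β {projᵍ} (λ As n → some λ i → and (member i) (constant _))
                                       (λ N n → some λ i → and (constant _) (member ⟨ suc i , n ⟩))
                                       (numᵍ (toℕ i)) (tagged (seqᵍ As))
        q = part-tagged (suc (toℕ i)) (seqᵍ As)
    in w , x , ≐-trans y
         ( (λ { {n} (_ , refl , n∈) → subst (n ∈_) (nth-lookup As i) (proj₁ q n∈) })
         , (λ {n} n∈ → toℕ i , refl , proj₂ q (subst (n ∈_) (sym (nth-lookup As i)) n∈)) )

  append-β = graph₂-β {λ As A → tagged (appendᵍ As A)}
    (λ A → tagged-continuous {λ As → appendᵍ As A} λ { zero n    → some λ l → and (member ⟨ 0 , l ⟩) (constant _)
                               ; (suc i) n → or (member ⟨ suc i , n ⟩) (and (member ⟨ 0 , i ⟩) (constant _)) })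
    (λ As → tagged-continuous {appendᵍ As} λ { zero n    → constant _
                                ; (suc i) n → or (constant _) (and (constant _) (member n)) })

{-# OPTIONS --safe #-}
-- Let V be open with X ∈ V and Y ∉ V.  For every P the function sending A to X
-- if A ⊆ P and to Y otherwise is computed in 𝒫ℕ[C] with one query to C, namely
-- "is A ∩ ∁ P inhabited?", so {A | A ⊆ P} is open.  As C is representable too,
-- {A | ∁ A ⊆ ∁ P} is open, and the two sets meet in {P}: every point is isolated.
module Submission where

open import Defs
open import Level using (Level; _⊔_; Lift; lift) renaming (suc to lsuc)
open import Axiom.DoubleNegationElimination using (em⇒dne)
open import Axiom.ExcludedMiddle using (ExcludedMiddle)
open import Data.Empty using (⊥; ⊥-elim)
open import Data.Fin.Base using () renaming (zero to fzero; suc to fsuc)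
open import Data.List.Base using ([]; _∷_)
open import Data.Product.Base using (∃-syntax; _×_; _,_; proj₁; proj₂)
open import Data.Sum.Base using (_⊎_; inj₁; inj₂; [_,_]′)
open import Data.Unit.Base using (⊤; tt)
open import Function.Base using (_∘_; id)
open import Function.Bundles using (_⇔_; mk⇔; Equivalence)
open import Relation.Binary.Bundles using (Setoid)
open import Relation.Nullary using (¬_; yes; no)
open import Relation.Unary using (Pred; _∈_; _∉_; _⊆_; _≐_; ∁; _∩_)
open import Relation.Unary.Properties using (≐-refl; ≐-sym; ≐-trans)

open Equivalence using (to; from)
open FinitaryClosure

private
  variable
    c ℓ o p q t : Level

-- The largest partial function that `a` represents, so `Repcon` applies to it with `a` itself as
-- the witness.
appFunction : (𝒜 : PartialApplicative c ℓ p) → PartialApplicative.Carrier 𝒜 →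
              PartialFunction (PartialApplicative.setoid 𝒜) p
appFunction 𝒜 a = record
  { Graph      = a ·_↦_
  ; resp       = ↦-resp ≈-refl
  ; functional = ↦-functional
  }
  where open PartialApplicative 𝒜

-- Isolated points and the two trivial topologies.

module _ {S : Setoid c ℓ} (τ : Topology S o t) where
  open Setoid S using (Carrier; _≈_)
  open Topology τ

  -- The union of a family with one member is that member, up to `≐`.
  Open-≐ : ∀ {V W} → Open W → V ≐ W → Open V
  Open-≐ {W = W} W-open (V⊆W , W⊆V) =
    ⋃-open {I = Lift _ ⊤} (λ _ → W) (λ _ → W-open) ((lift tt ,_) ∘ V⊆W , W⊆V ∘ proj₂)

  Isolated : Carrier → Set _
  Isolated x = ∃[ W ] (Open W × (∀ y → y ∈ W ⇔ x ≈ y))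

  isolated⇒discrete : (∀ x → Isolated x) → Discrete τ
  isolated⇒discrete isolated V V-resp =
    -- `V` is the union of the singletons of its points; the lift meets the index level that
    -- `⋃-open` prescribes.
    ⋃-open {I = Lift (lsuc o ⊔ c ⊔ t) (∃[ x ] x ∈ V)}
      (λ (lift (x , _)) → proj₁ (isolated x))
      (λ (lift (x , _)) → proj₁ (proj₂ (isolated x)))
      ( (λ {y} y∈ → lift (y , y∈) , from (proj₂ (proj₂ (isolated y)) y) (Setoid.refl S))
      , (λ {y} (lift (x , x∈) , y∈) → V-resp (to (proj₂ (proj₂ (isolated x)) y) y∈) x∈))

  discrete⇒continuous : (∀ {a} → ExcludedMiddle a) → Discrete τ →
                        (f : PartialFunction S q) → ContinuousOnDomain τ f
  discrete⇒continuous em discrete f {W} W-open =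
      V , discrete V V-resp , λ gxy → mk⇔
        (λ x∈ → let (y′ , g′ , y′∈) = decide⁻ x∈ in Open-resp W-open (functional g′ gxy) y′∈)
        (λ y∈ → decide⁺ (_ , gxy , y∈))
    where
    open PartialFunction f
    Preimage : Carrier → Set _
    Preimage x = ∃[ y ] (Graph x y × y ∈ W)
    -- Excluded middle brings the preimage down to the level o.
    V : Pred Carrier o
    V x with em {P = Preimage x}
    ... | yes _ = Lift o ⊤
    ... | no  _ = Lift o ⊥
    decide⁻ : ∀ {x} → x ∈ V → Preimage x
    decide⁻ {x} x∈ with em {P = Preimage x}
    ... | yes w = w
    decide⁻ (lift ()) | no _
    decide⁺ : ∀ {x} → Preimage x → x ∈ V
    decide⁺ {x} w with em {P = Preimage x}
    ... | yes _ = lift tt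
    ... | no ¬w = ⊥-elim (¬w w)
    V-resp : ∀ {x y} → x ≈ y → x ∈ V → y ∈ V
    V-resp x≈y x∈ = let (z , g , z∈) = decide⁻ x∈ in
                    decide⁺ (z , resp x≈y (Setoid.refl S) g , z∈)

  indiscrete⇒continuous : Indiscrete τ → (f : PartialFunction S q) → ContinuousOnDomain τ f
  indiscrete⇒continuous indiscrete f {W} W-open = W , W-open , λ {x} {y} _ → same x y
    where
    same : ∀ x y → x ∈ W ⇔ y ∈ W
    same x y with indiscrete W W-open
    ... | inj₁ empty = mk⇔ (⊥-elim ∘ empty x) (⊥-elim ∘ empty y)
    ... | inj₂ full  = mk⇔ (λ _ → full y) (λ _ → full x)

  -- Failure of indiscreteness in witness form; `x` and `y` become the two values of the test
  -- function in `lowerSet-open`.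
  Separating : Set _
  Separating = ∃[ V ] ∃[ x ] ∃[ y ] (Open V × x ∈ V × y ∉ V)

  ¬separating⇒indiscrete : (∀ {a} → ExcludedMiddle a) → ¬ Separating → Indiscrete τ
  ¬separating⇒indiscrete em ¬sep V V-open with em {P = ∃[ x ] x ∈ V}
  ... | no ¬x         = inj₁ λ x x∈ → ¬x (x , x∈)
  ... | yes (x , x∈) = inj₂ λ y → em⇒dne em λ y∉ → ¬sep (V , x , y , V-open , x∈ , y∉)

-- Programs that query the oracle once.

module TotalApplication (𝒜 : PCA c ℓ p) (κ : Coding 𝒜)
                        (app : PCA.Carrier 𝒜 → PCA.Carrier 𝒜 → PCA.Carrier 𝒜)
                        (app-law : ∀ a b → PCA._·_↦_ 𝒜 a b (app a b)) where
  open PCA 𝒜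
  open Coding κ

  infixl 7 _∙_
  _∙_ : Carrier → Carrier → Carrier
  _∙_ = app

  ∙-cong : ∀ {a a′ b b′} → a ≈ a′ → b ≈ b′ → a ∙ b ≈ a′ ∙ b′
  ∙-cong a≈ b≈ = ↦-functional (↦-resp a≈ b≈ ≈-refl (app-law _ _)) (app-law _ _)

  -- Lets the coding laws be chained through nested terms, where an argument is known only up to
  -- `≈`.
  value₁ : ∀ {a b b′ d} → b ≈ b′ → a · b′ ↦ d → a ∙ b ≈ d
  value₁ b≈ ab = ≈-trans (∙-cong ≈-refl b≈) (↦-functional (app-law _ _) ab)

  value₂ : ∀ {a b b′ c c′ d} → b ≈ b′ → c ≈ c′ → a · b′ · c′ ↦ d → a ∙ b ∙ c ≈ d
  value₂ b≈ c≈ (_ , ab , uc) = ≈-trans (∙-cong (value₁ b≈ ab) ≈-refl) (value₁ c≈ uc)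

  value₃ : ∀ {a b b′ c c′ d d′ x} → b ≈ b′ → c ≈ c′ → d ≈ d′ →
           a · b′ · c′ · d′ ↦ x → a ∙ b ∙ c ∙ d ≈ x
  value₃ b≈ c≈ d≈ (_ , abc , ud) = ≈-trans (∙-cong (value₂ b≈ c≈ abc) ≈-refl) (value₁ d≈ ud)

  module _ (q r : Carrier) where

    -- In 𝒜[f] the same element is applied again to each longer history, so one program must serve
    -- both rounds: on [b] it requests the value of f at qb, on [b, v] it returns rbv.
    first second asking oneQueryStep : Carrier → Carrier
    first  x = projectionᶜ ∙ numeral 0 ∙ x
    second x = projectionᶜ ∙ numeral 1 ∙ x
    -- The history contains the input as well, so the number of answers received is its length minus
    -- one.
    asking x = zero?ᶜ ∙ (predᶜ ∙ (lengthᶜ ∙ x))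
    oneQueryStep x = D ∙ asking x ∙ (pairᶜ ∙ F ∙ (q ∙ first x))
                                  ∙ (pairᶜ ∙ T ∙ (r ∙ first x ∙ second x))

    oneQueryStep-asks : ∀ {b e} → q · b ↦ e → oneQueryStep (seq (b ∷ [])) ≈ pair F e
    oneQueryStep-asks {b} qb = value₃
      (value₁ (value₁ (value₁ ≈-refl (lengthᶜ-law h)) (predᶜ-law 0)) zero?ᶜ-zero)
      (value₂ ≈-refl (value₁ (value₂ ≈-refl ≈-refl (projectionᶜ-law h fzero)) qb) (pairᶜ-law _ _))
      -- The discarded branch reads a second entry that [b] does not have. The codings do not fix
      -- its value, but application is total and `D-T` accepts any value.
      ≈-refl
      (D-T _ _)
      where h = b ∷ []

    oneQueryStep-answers : ∀ {b v d} → r · b · v ↦ d → oneQueryStep (seq (b ∷ v ∷ [])) ≈ pair T d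
    oneQueryStep-answers {b} {v} rbv = value₃
      (value₁ (value₁ (value₁ ≈-refl (lengthᶜ-law h)) (predᶜ-law 1)) (zero?ᶜ-suc 0))
      ≈-refl
      (value₂ ≈-refl
        (value₂ (value₂ ≈-refl ≈-refl (projectionᶜ-law h fzero))
                (value₂ ≈-refl ≈-refl (projectionᶜ-law h (fsuc fzero))) rbv)
        (pairᶜ-law _ _))
      (D-F _ _)
      where h = b ∷ v ∷ []

    -- The element `a` is a parameter because the graph model can supply it directly, by `graph-β`
    -- from the continuity of `oneQueryStep`.
    oneQuery : (f : PartialFunction setoid o) → ∀ {a} → (∀ x → a · x ↦ oneQueryStep x) →
               ∀ {b e v d} → q · b ↦ e → PartialFunction.Graph f e v → r · b · v ↦ d →
               Dialogue 𝒜 κ f a b d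
    oneQuery f a· {e = e} {v} qb fe rbv = record
      { n      = 1
      ; e      = λ _ → e
      ; v      = λ _ → v
      ; answer = λ _ → fe
      ; query  = λ { fzero → ↦-resp ≈-refl ≈-refl (oneQueryStep-asks qb) (a· _) }
      ; result = ↦-resp ≈-refl ≈-refl (oneQueryStep-answers rbv) (a· _)
      }

module _ (κ : Coding 𝒫ℕ) where
  open TotalApplication 𝒫ℕ κ _∘ᵍ_ (λ _ _ → ≐-refl)

  -- `E` computes the query, and `R` the result from input and answer; being continuous, both have
  -- graphs that represent them. Complement is total, so every query is answered.
  oneQueryᵍ : ∀ {E : 𝒫 → 𝒫} {R : 𝒫 → 𝒫 → 𝒫} → Continuous E →
              (∀ B → Continuous (λ A → R A B)) → (∀ A → Continuous (R A)) →
              ∃[ a ] (∀ A → Dialogue 𝒫ℕ κ complement a A (R A (∁ (E A))))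
  oneQueryᵍ {E} {R} cE cR₁ cR₂ =
    let q = graph E
        r = graph₂ R
    in graph (oneQueryStep q r) , λ A →
         oneQuery q r complement {a = graph (oneQueryStep q r)} (graph-β (cStep q r))
           (graph-β cE A) ≐-refl (graph₂-β cR₁ cR₂ A (∁ (E A)))
    where
    open Coding κ
    cStep : ∀ q r → Continuous (oneQueryStep q r)
    cStep q r =
      apply (apply (apply (const-continuous D)
                          (apply (const-continuous zero?ᶜ)
                                 (apply (const-continuous predᶜ) (apply (const-continuous lengthᶜ) identity))))
                   (apply (const-continuous (pairᶜ ∘ᵍ F)) (apply (const-continuous q) cFirst)))
            (apply (const-continuous (pairᶜ ∘ᵍ T)) (apply (apply (const-continuous r) cFirst) cSecond))
      where
      cFirst : Continuous (first q r)
      cFirst = apply (const-continuous (projectionᶜ ∘ᵍ numeral 0)) identity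
      cSecond : Continuous (second q r)
      cSecond = apply (const-continuous (projectionᶜ ∘ᵍ numeral 1)) identity

  module _ (τ : Topology (PCA.setoid 𝒫ℕ) o t) (repcon : Repcon (𝒫ℕ [ κ , complement ]) τ) where
    open Topology τ

    -- The function computed by the one-query program is total, so the open set given by continuity
    -- on its domain is the whole preimage.
    preimage-open : ∀ {E : 𝒫 → 𝒫} {R : 𝒫 → 𝒫 → 𝒫} → Continuous E → (∀ B → Continuous (λ A → R A B)) → (∀ A → Continuous (R A)) →
                    ∀ {W} → Open W → Open (λ A → R A (∁ (E A)) ∈ W)
    preimage-open {E} {R} cE cR₁ cR₂ W-open =
      let (a , a·) = oneQueryᵍ {E} {R} cE cR₁ cR₂
          (V , V-open , V⇔) = repcon (appFunction (𝒫ℕ [ κ , complement ]) a) (a , id) W-open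
      in Open-≐ τ V-open ((λ {A} → from (V⇔ (a· A))) , (λ {A} → to (V⇔ (a· A))))

    ∁-preimage-open : ∀ {W} → Open W → Open (λ A → ∁ A ∈ W)
    -- The query is the input itself, and the answer is returned unchanged.
    ∁-preimage-open = preimage-open {E = id} {R = λ _ B → B} identity const-continuous (λ _ → identity)

    module _ (em : ∀ {a} → ExcludedMiddle a) where

      lowerSet-open : Separating τ → ∀ P → ∃[ W ] (Open W × (∀ A → A ∈ W ⇔ A ⊆ P))
      lowerSet-open (V , X , Y , V-open , X∈V , Y∉V) P =
          (λ A → R A (∁ (E A)) ∈ V)
        , preimage-open {E} {R} cE cR₁ cR₂ V-open
        , λ A → mk⇔
            -- A point of A outside P would make the value Y, which is not in V.
            (λ R∈ {m} m∈ → em⇒dne em λ m∉ → Y∉V (Open-resp V-open (outside A (m , m∈ , m∉)) R∈))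
            (λ A⊆P → Open-resp V-open (≐-sym (inside A A⊆P)) X∈V)
        where
        Exceeds : 𝒫 → Set
        Exceeds A = ∃[ m ] (m ∈ A × m ∉ P)
        E : 𝒫 → 𝒫
        -- All of ℕ or empty, so any fixed number, here 0, lies in the complement exactly when A
        -- does not exceed P.
        E A _ = Exceeds A
        R : 𝒫 → 𝒫 → 𝒫
        -- Inclusion in P is not monotone in A, so `R` tests only for an excess, which is finitary,
        -- and learns its absence from the answer B.
        R A B n = (Exceeds A × n ∈ Y) ⊎ (0 ∈ B × n ∈ X)
        exceeds : Finitary Exceeds
        exceeds = some λ m → and (member m) (constant (m ∉ P))
        cE : Continuous E
        cE _ = exceeds
        cR₁ : ∀ B → Continuous (λ A → R A B)
        cR₁ B n = or (and exceeds (constant (n ∈ Y))) (constant (0 ∈ B × n ∈ X))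
        cR₂ : ∀ A → Continuous (R A)
        cR₂ A n = or (constant (Exceeds A × n ∈ Y)) (and (member 0) (constant (n ∈ X)))
        outside : ∀ A → Exceeds A → R A (∁ (E A)) ≐ Y
        outside A ex = [ proj₂ , (λ (¬ex , _) → ⊥-elim (¬ex ex)) ]′ , λ n∈ → inj₁ (ex , n∈)
        inside : ∀ A → A ⊆ P → R A (∁ (E A)) ≐ X
        inside A A⊆P = [ (λ (ex , _) → ⊥-elim (¬ex ex)) , proj₂ ]′ , λ n∈ → inj₂ (¬ex , n∈)
          where
          ¬ex : ¬ Exceeds A
          ¬ex (_ , m∈ , m∉) = m∉ (A⊆P m∈)

      separating⇒isolated : Separating τ → ∀ P → Isolated τ P
      separating⇒isolated sep P =
        let (V , V-open , V⇔) = lowerSet-open sep P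
            -- Pulled back along complement, the subsets of `∁ P` become the supersets of P.
            (W , W-open , W⇔) = lowerSet-open sep (∁ P)
        in V ∩ (λ A → ∁ A ∈ W) , ∩-open V-open (∁-preimage-open W-open) , λ A → mk⇔
             (λ (A∈V , ∁A∈W) →
               (λ n∈P → em⇒dne em λ n∉A → to (W⇔ (∁ A)) ∁A∈W n∉A n∈P) , to (V⇔ A) A∈V)
             (λ (P⊆A , A⊆P) → from (V⇔ A) A⊆P , from (W⇔ (∁ A)) (λ n∉A → n∉A ∘ P⊆A))

corollary2p2 : (∀ {ℓ : Level} → ExcludedMiddle ℓ) →
    (κ : Coding 𝒫ℕ) →
    ∀ {o t : Level} (τ : Topology (PCA.setoid 𝒫ℕ) o t) →
    Repcon (𝒫ℕ [ κ , complement ]) τ ⇔ (Discrete τ ⊎ Indiscrete τ)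
corollary2p2 em κ τ = mk⇔ trivial
    [ (λ discrete f _ → discrete⇒continuous τ em discrete f)
    , (λ indiscrete f _ → indiscrete⇒continuous τ indiscrete f) ]′
  where
  trivial : Repcon (𝒫ℕ [ κ , complement ]) τ → Discrete τ ⊎ Indiscrete τ
  trivial repcon with em {P = Separating τ}
  ... | yes sep = inj₁ (isolated⇒discrete τ (separating⇒isolated κ τ repcon em sep))
  ... | no ¬sep = inj₂ (¬separating⇒indiscrete τ em ¬sep)
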